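{- For every integer $n\geq 2$, $$x\,C_{n}(x)=(1+x)\,T_n(x),$$ where $C_n(x)=xW_n(x^2)+\widetilde{W}_n(x^2)$.
   Context: $\mathfrak{S}_n$ is the set of permutations $\pi=\pi(1)\cdots\pi(n)$ of $\{1,\ldots,n\}$. An interior peak of $\pi\in\mathfrak{S}_n$ is an index $i\in\{2,\ldots,n-1\}$ with $\pi(i-1)<\pi(i)>\pi(i+1)$; a left peak is an index $i\in\{1,\ldots,n-1\}$ with $\pi(i-1)<\pi(i)>\pi(i+1)$, where $\pi(0)=0$. $W(n,k)$ (resp. $\widetilde{W}(n,k)$) is the number of $\pi\in\mathfrak{S}_n$ with $k$ interior peaks (resp. $k$ left peaks); $W_n(x)=\sum_{k\ge 0}W(n,k)x^k$ and $\widetilde{W}_n(x)=\sum_{k\ge 0}\widetilde{W}(n,k)x^k$. An alternating subsequence of $\pi$ of length $k$ is a subsequence $\pi(i_1),\ldots,\pi(i_k)$ with $i_1<\cdots<i_k$ and $\pi(i_1)>\pi(i_2)<\pi(i_3)>\cdots\pi(i_k)$ (starting with a descent and alternating thereafter; any sequence of length 1 qualifies). $\mathrm{as}(\pi)$ is the maximal length of an alternating subsequence of $\pi$, $a_k(n)=\#\{\pi\in\mathfrak{S}_n:\mathrm{as}(\pi)=k\}$, and $T_n(x)=\sum_{k=1}^n a_k(n)x^k$. -}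

module Defs where

open import Data.Fin using (Fin; zero; suc; toℕ; fromℕ<; punchIn)
open import Data.Fin.Permutation as Perm
  using (Permutation′; _⟨$⟩ʳ_; insert; remove; insert-punchIn; insert-remove)
open import Data.Fin.Properties using (punchIn-injective)
open import Data.List
  using (List; []; _∷_; _++_; length; filter; map; applyUpTo; upTo; allFin; cartesianProductWith)
open import Data.List.Extrema.Nat using (max)
open import Data.List.Membership.Propositional using (_∈_)
open import Data.List.Membership.Propositional.Properties
  using (∈-allFin; ∈-++⁺ˡ; ∈-++⁺ʳ; ∈-++⁻; ∈-map⁺; ∈-map⁻)
open import Data.List.Properties using (length-filter; length-upTo; filter-none)
open import Data.List.Relation.Binary.Sublist.Propositional using (_⊆_; []; _∷_; _∷ʳ_)
open import Data.List.Relation.Unary.All using (All; []; _∷_; universal)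
import Data.List.Relation.Unary.All.Properties as All
open import Data.List.Relation.Unary.AllPairs as AllPairs using (AllPairs; []; _∷_)
import Data.List.Relation.Unary.AllPairs.Properties as AllPairsₚ
open import Data.List.Relation.Unary.Any using (Any; here; there)
import Data.List.Relation.Unary.Any.Properties as Any
import Data.List.Relation.Unary.Unique.Propositional.Properties as Unique
open import Data.Nat using (ℕ; zero; suc; pred; _+_; _*_; _≤_; _<_; _>_; _≤?_; _<?_; _≟_)
open import Data.Nat.Properties using (<⇒≢; ≤-<-trans; ≤-trans; ≤-reflexive)
open import Data.Product using (_×_; _,_)
open import Data.Sum using (inj₁; inj₂)
open import Data.Unit using (⊤; tt)
open import Relation.Binary.PropositionalEquality using (_≡_; _≢_; refl; sym; trans; cong)
open import Relation.Nullary using (¬_; yes; no)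
open import Relation.Nullary.Decidable using (_×-dec_)
open import Relation.Unary using (Pred; Decidable)

-- Polynomials in one variable over ℕ: the entry at position k is the
-- coefficient of x^k.  Trailing zeros are allowed, so equality is _≈_.

Poly : Set
Poly = List ℕ

coeff : Poly → ℕ → ℕ
coeff []      _       = 0
coeff (a ∷ p) zero    = a
coeff (a ∷ p) (suc k) = coeff p k

infix  4 _≈_
infixl 6 _⊕_
infixl 7 _⊗_
infixl 8 _[_]

_≈_ : Poly → Poly → Set
p ≈ q = ∀ k → coeff p k ≡ coeff q k

_⊕_ : Poly → Poly → Poly
[]      ⊕ q       = q
(a ∷ p) ⊕ []      = a ∷ p
(a ∷ p) ⊕ (b ∷ q) = (a + b) ∷ (p ⊕ q)

_⊗_ : Poly → Poly → Poly
[]      ⊗ q = []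
(a ∷ p) ⊗ q = map (a *_) q ⊕ (0 ∷ (p ⊗ q))

-- Substitution: p [ q ] is p(q(x)).
_[_] : Poly → Poly → Poly
[]      [ q ] = []
(a ∷ p) [ q ] = (a ∷ []) ⊕ q ⊗ (p [ q ])

𝟙 : Poly
𝟙 = 1 ∷ []

X : Poly
X = 0 ∷ 1 ∷ []

-- A permutation of Fin (suc n) is determined by the image of zero and by
-- the permutation left after removing zero and its image.  By 𝔖-complete
-- and 𝔖-distinct every permutation is listed exactly once, up to the
-- pointwise equality of permutations.

𝔖 : ∀ n → List (Permutation′ n)
𝔖 zero    = Perm.id ∷ []
𝔖 (suc n) = cartesianProductWith (insert zero) (allFin (suc n)) (𝔖 n)

insert-cong : ∀ {n} (j : Fin (suc n)) {π ρ : Permutation′ n} →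
              π Perm.≈ ρ → insert zero j π Perm.≈ insert zero j ρ
insert-cong j {π} {ρ} e zero    = refl
insert-cong j {π} {ρ} e (suc i) =
  trans (insert-punchIn zero j π i)
    (trans (cong (punchIn j) (e i)) (sym (insert-punchIn zero j ρ i)))

𝔖-complete : ∀ {n} (π : Permutation′ n) → Any (π Perm.≈_) (𝔖 n)
𝔖-complete {zero}  π = here λ ()
𝔖-complete {suc n} π =
  Any.cartesianProductWith⁺ (insert zero)
    (λ { {_} {ρ} refl e i → trans (sym (insert-remove zero π i))
                                  (insert-cong (π ⟨$⟩ʳ zero) {remove zero π} {ρ} e i) })
    (∈-allFin (π ⟨$⟩ʳ zero)) (𝔖-complete (remove zero π))

𝔖-distinct : ∀ n → AllPairs (λ π ρ → ¬ π Perm.≈ ρ) (𝔖 n)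
𝔖-distinct zero    = [] ∷ []
𝔖-distinct (suc n) = go (allFin (suc n)) (Unique.allFin⁺ (suc n))
  where
  row : ∀ j (πs : List (Permutation′ n)) → AllPairs (λ π ρ → ¬ π Perm.≈ ρ) πs →
        AllPairs (λ π ρ → ¬ π Perm.≈ ρ) (map (insert zero j) πs)
  row j πs ds = AllPairsₚ.map⁺ (AllPairs.map (λ {π} {ρ} ne e →
    ne λ i → punchIn-injective j _ _
      (trans (sym (insert-punchIn zero j π i))
        (trans (e (suc i)) (insert-punchIn zero j ρ i)))) ds)

  apart : ∀ {j} js → All (j ≢_) js → ∀ (π : Permutation′ n) →
          All (λ ρ → ¬ insert zero j π Perm.≈ ρ) (cartesianProductWith (insert zero) js (𝔖 n))
  apart []        []          π = []
  apart (j′ ∷ js) (ne ∷ nes) π =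
    All.++⁺ (All.map⁺ (universal (λ ρ e → ne (e zero)) (𝔖 n))) (apart js nes π)

  go : ∀ js → AllPairs _≢_ js →
       AllPairs (λ π ρ → ¬ π Perm.≈ ρ) (cartesianProductWith (insert zero) js (𝔖 n))
  go []       []         = []
  go (j ∷ js) (nes ∷ us) =
    AllPairsₚ.++⁺ (row j (𝔖 n) (𝔖-distinct n)) (go js us)
      (All.map⁺ (universal (apart js nes) (𝔖 n)))

#𝔖 : ∀ n {ℓ} {P : Pred (Permutation′ n) ℓ} → Decidable P → ℕ
#𝔖 n P? = length (filter P? (𝔖 n))

-- The value π(i) with positions and values numbered from 1, and π(0) = 0.
-- The value 0 at positions beyond n is never used: a peak i satisfies i < n.
at : ∀ {n} → Permutation′ n → ℕ → ℕ
at π zero = 0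
at {n} π (suc i) with i <? n
... | yes i<n = suc (toℕ (π ⟨$⟩ʳ fromℕ< i<n))
... | no  _   = 0

Peak : ∀ {n} → Permutation′ n → ℕ → Set
Peak π i = at π (pred i) < at π i × at π i > at π (suc i)

InteriorPeak : ∀ {n} → Permutation′ n → ℕ → Set
InteriorPeak π i = 2 ≤ i × Peak π i

LeftPeak : ∀ {n} → Permutation′ n → ℕ → Set
LeftPeak π i = 1 ≤ i × Peak π i

peak? : ∀ {n} (π : Permutation′ n) → Decidable (Peak π)
peak? π i = (at π (pred i) <? at π i) ×-dec (at π (suc i) <? at π i)

interiorPeak? : ∀ {n} (π : Permutation′ n) → Decidable (InteriorPeak π)
interiorPeak? π i = (2 ≤? i) ×-dec peak? π i

leftPeak? : ∀ {n} (π : Permutation′ n) → Decidable (LeftPeak π)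
leftPeak? π i = (1 ≤? i) ×-dec peak? π i

-- upTo n is 0, …, n − 1, which supplies the upper bound i ≤ n − 1.
interiorPeaks : ∀ {n} → Permutation′ n → ℕ
interiorPeaks {n} π = length (filter (interiorPeak? π) (upTo n))

leftPeaks : ∀ {n} → Permutation′ n → ℕ
leftPeaks {n} π = length (filter (leftPeak? π) (upTo n))

W : ℕ → ℕ → ℕ
W n k = #𝔖 n (λ π → interiorPeaks π ≟ k)

W~ : ℕ → ℕ → ℕ
W~ n k = #𝔖 n (λ π → leftPeaks π ≟ k)

-- The sums over all k ≥ 0 stop at k = n, by W-vanishes and W~-vanishes.
W[x] : ℕ → Poly
W[x] n = applyUpTo (W n) (suc n)

W~[x] : ℕ → Poly
W~[x] n = applyUpTo (W~ n) (suc n)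

#𝔖-vanishes : ∀ n (f : Permutation′ n → ℕ) → (∀ π → f π ≤ n) →
              ∀ {k} → n < k → #𝔖 n (λ π → f π ≟ k) ≡ 0
#𝔖-vanishes n f f≤n {k} n<k =
  cong length (filter-none (λ π → f π ≟ k)
    (universal (λ π → <⇒≢ (≤-<-trans (f≤n π) n<k)) (𝔖 n)))

W-vanishes : ∀ {n k} → n < k → W n k ≡ 0
W-vanishes {n} = #𝔖-vanishes n interiorPeaks λ π →
  ≤-trans (length-filter (interiorPeak? π) (upTo n)) (≤-reflexive (length-upTo n))

W~-vanishes : ∀ {n k} → n < k → W~ n k ≡ 0
W~-vanishes {n} = #𝔖-vanishes n leftPeaks λ π →
  ≤-trans (length-filter (leftPeak? π) (upTo n)) (≤-reflexive (length-upTo n))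

C[x] : ℕ → Poly
C[x] n = X ⊗ W[x] n [ X ⊗ X ] ⊕ W~[x] n [ X ⊗ X ]

word : ∀ {n} → Permutation′ n → List ℕ
word {n} π = applyUpTo (λ i → at π (suc i)) n

subsequences : List ℕ → List (List ℕ)
subsequences []       = [] ∷ []
subsequences (x ∷ xs) = map (x ∷_) (subsequences xs) ++ subsequences xs

⊆⇒∈-subsequences : ∀ {ys xs} → ys ⊆ xs → ys ∈ subsequences xs
⊆⇒∈-subsequences []         = here refl
⊆⇒∈-subsequences (x ∷ʳ s)   = ∈-++⁺ʳ (map (x ∷_) _) (⊆⇒∈-subsequences s)
⊆⇒∈-subsequences (refl ∷ s) = ∈-++⁺ˡ (∈-map⁺ (_ ∷_) (⊆⇒∈-subsequences s))

∈-subsequences⇒⊆ : ∀ {ys} xs → ys ∈ subsequences xs → ys ⊆ xs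
∈-subsequences⇒⊆ []       (here refl) = []
∈-subsequences⇒⊆ (x ∷ xs) m with ∈-++⁻ (map (x ∷_) (subsequences xs)) m
... | inj₂ m₂ = x ∷ʳ ∈-subsequences⇒⊆ xs m₂
... | inj₁ m₁ with ∈-map⁻ (x ∷_) m₁
...   | _ , m′ , refl = refl ∷ ∈-subsequences⇒⊆ xs m′

-- Alternating starts with a descent, Alternating′ with an ascent.  The empty
-- sequence counts as alternating, which does not affect the maximal length.
mutual
  Alternating : List ℕ → Set
  Alternating []           = ⊤
  Alternating (x ∷ [])     = ⊤
  Alternating (x ∷ y ∷ zs) = x > y × Alternating′ (y ∷ zs)

  Alternating′ : List ℕ → Set
  Alternating′ []           = ⊤
  Alternating′ (x ∷ [])     = ⊤
  Alternating′ (x ∷ y ∷ zs) = x < y × Alternating (y ∷ zs)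

mutual
  alternating? : Decidable Alternating
  alternating? []           = yes tt
  alternating? (x ∷ [])     = yes tt
  alternating? (x ∷ y ∷ zs) = (y <? x) ×-dec alternating′? (y ∷ zs)

  alternating′? : Decidable Alternating′
  alternating′? []           = yes tt
  alternating′? (x ∷ [])     = yes tt
  alternating′? (x ∷ y ∷ zs) = (x <? y) ×-dec alternating? (y ∷ zs)

as : ∀ {n} → Permutation′ n → ℕ
as π = max 0 (map length (filter alternating? (subsequences (word π))))

a : ℕ → ℕ → ℕ
a k n = #𝔖 n (λ π → as π ≟ k)

-- The sum runs over 1 ≤ k ≤ n, so the constant coefficient is 0.
T[x] : ℕ → Poly
T[x] n = 0 ∷ applyUpTo (λ j → a (suc j) n) n

{-# OPTIONS --safe #-}

-- Let r be the number of monotone runs of π after its initial ascending run.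
-- A longest alternating subsequence takes one term more, so as π = r + 1.  The
-- runs after the initial one alternately descend and ascend.  Every left peak
-- starts a descending run, so leftPeaks π = ⌈r/2⌉ = ⌊as π/2⌋; every interior
-- valley starts an ascending one, so π has ⌊r/2⌋ = ⌊(as π − 1)/2⌋ of them.
-- Complementation i ↦ n + 1 − i of the values turns valleys into peaks, whence
--   W~(n,k) = a_{2k+1}(n) + a_{2k}(n),   W(n,k) = a_{2k+2}(n) + a_{2k+1}(n),
-- which are the odd and the even coefficients of the claim.
module Submission where

open import Defs

open import Data.Empty using (⊥-elim)
open import Data.Fin using (Fin; zero; suc; toℕ; fromℕ<; opposite)
open import Data.Fin.Permutation as Perm using (Permutation′; _⟨$⟩ʳ_; _∘ₚ_)
open import Data.Fin.Properties
  using (toℕ<n; toℕ-injective; toℕ-fromℕ<; opposite-prop; opposite-involutive; injective⇒≤)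
open import Data.List using (List; []; _∷_; length; filter; map; applyUpTo; upTo; lookup)
open import Data.List.Extrema.Nat using (max; max≤v⁺; v≤max⁺)
open import Data.List.Membership.Propositional using (_∈_)
open import Data.List.Membership.Propositional.Properties
  using (∈-filter⁺; ∈-filter⁻; ∈-map⁺; ∈-map⁻; ∈-lookup)
import Data.List.Membership.Setoid.Properties as Membershipₛ
open import Data.List.Properties using (length-applyUpTo; filter-accept; filter-reject; filter-≐)
open import Data.List.Relation.Binary.Sublist.Propositional using (_⊆_; []; _∷_; _∷ʳ_)
open import Data.List.Relation.Unary.All as All using (_∷_)
open import Data.List.Relation.Unary.AllPairs using (AllPairs; _∷_)
import Data.List.Relation.Unary.AllPairs.Properties as AllPairsₚ
open import Data.List.Relation.Unary.Any as Any using (Any)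
open import Data.Nat
open import Data.Nat.Properties
open import Data.Product using (_×_; _,_; proj₁; proj₂; ∃₂)
open import Data.Sum using (_⊎_; inj₁; inj₂; [_,_]′; swap)
import Data.Sum as Sum
open import Data.Unit using (⊤; tt)
open import Function using (_∘_; flip; _⇔_; mk⇔; Equivalence; Congruent; Injection; Injective)
open import Function.Properties.Inverse using (↔⇒↣)
open import Level using (0ℓ)
open import Relation.Binary using (Rel; Setoid; Decidable; Asymmetric; Cotransitive; _Respects_; tri<; tri≈; tri>)
open import Relation.Binary.PropositionalEquality
  using (_≡_; _≗_; refl; sym; trans; cong; cong₂; subst; subst₂; module ≡-Reasoning)
open import Relation.Nullary using (¬_; yes; no; contradiction)
open import Relation.Nullary.Decidable using (_×-dec_)
open import Relation.Unary using (Pred; _≐_) renaming (Decidable to Decidable₁)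

private
  variable
    A B : Set
    R : Rel A 0ℓ

-- Counting by filtering, and halves of natural numbers.

length-filter-applyUpTo : {P : Pred A 0ℓ} {Q : Pred B 0ℓ} (P? : Decidable₁ P) (Q? : Decidable₁ Q)
                          (f : ℕ → A) (g : ℕ → B) (n : ℕ) →
                          (∀ {i} → i < n → P (f i) ⇔ Q (g i)) →
                          length (filter P? (applyUpTo f n)) ≡ length (filter Q? (applyUpTo g n))
length-filter-applyUpTo P? Q? f g zero    P⇔Q = refl
length-filter-applyUpTo P? Q? f g (suc n) P⇔Q
  with ih ← length-filter-applyUpTo P? Q? (f ∘ suc) (g ∘ suc) n (P⇔Q ∘ s<s) | P? (f 0) | Q? (g 0)
... | yes _ | yes _ = cong suc ih
... | yes p | no ¬q = contradiction (Equivalence.to (P⇔Q z<s) p) ¬q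
... | no ¬p | yes q = contradiction (Equivalence.from (P⇔Q z<s) q) ¬p
... | no _  | no _  = ih

length-filter-⊎ : {P Q S : Pred A 0ℓ} (P? : Decidable₁ P) (Q? : Decidable₁ Q) (S? : Decidable₁ S) →
                  (∀ x → P x ⇔ (Q x ⊎ S x)) → (∀ {x} → Q x → ¬ S x) → ∀ xs →
                  length (filter P? xs) ≡ length (filter Q? xs) + length (filter S? xs)
length-filter-⊎ P? Q? S? P⇔Q⊎S disj [] = refl
length-filter-⊎ P? Q? S? P⇔Q⊎S disj (x ∷ xs)
  with ih ← length-filter-⊎ P? Q? S? P⇔Q⊎S disj xs | P? x | Q? x | S? x
... | _     | yes q | yes s = contradiction s (disj q)
... | yes _ | yes _ | no _  = cong suc ih
... | yes _ | no _  | yes _ = trans (cong suc ih) (sym (+-suc _ _))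
... | yes p | no ¬q | no ¬s = ⊥-elim ([ ¬q , ¬s ]′ (Equivalence.to (P⇔Q⊎S x) p))
... | no ¬p | yes q | no _  = contradiction (Equivalence.from (P⇔Q⊎S x) (inj₁ q)) ¬p
... | no ¬p | no _  | yes s = contradiction (Equivalence.from (P⇔Q⊎S x) (inj₂ s)) ¬p
... | no _  | no _  | no _  = ih

⌊n*2/2⌋≡n : ∀ n → ⌊ n * 2 /2⌋ ≡ n
⌊n*2/2⌋≡n zero    = refl
⌊n*2/2⌋≡n (suc n) = cong suc (⌊n*2/2⌋≡n n)

⌈n*2/2⌉≡n : ∀ n → ⌈ n * 2 /2⌉ ≡ n
⌈n*2/2⌉≡n zero    = refl
⌈n*2/2⌉≡n (suc n) = cong suc (⌈n*2/2⌉≡n n)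

n≡1+⌊n/2⌋*2⊎n≡⌊n/2⌋*2 : ∀ n → n ≡ suc (⌊ n /2⌋ * 2) ⊎ n ≡ ⌊ n /2⌋ * 2
n≡1+⌊n/2⌋*2⊎n≡⌊n/2⌋*2 0             = inj₂ refl
n≡1+⌊n/2⌋*2⊎n≡⌊n/2⌋*2 1             = inj₁ refl
n≡1+⌊n/2⌋*2⊎n≡⌊n/2⌋*2 (suc (suc n)) =
  Sum.map (cong (2 +_)) (cong (2 +_)) (n≡1+⌊n/2⌋*2⊎n≡⌊n/2⌋*2 n)

⌊m/2⌋≡n⇔ : ∀ m n → ⌊ m /2⌋ ≡ n ⇔ (m ≡ suc (n * 2) ⊎ m ≡ n * 2)
⌊m/2⌋≡n⇔ m n = mk⇔ (λ { refl → n≡1+⌊n/2⌋*2⊎n≡⌊n/2⌋*2 m })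
                   [ (λ { refl → ⌈n*2/2⌉≡n n }) , (λ { refl → ⌊n*2/2⌋≡n n }) ]′

-- Exactly two consecutive numbers have half `n`. This is where the sums of two adjacent a_k(n), and
-- hence the factor 1 + x, come from.
length-filter-⌊/2⌋ : (f : A → ℕ) (n : ℕ) (xs : List A) →
                     length (filter (λ x → ⌊ f x /2⌋ ≟ n) xs) ≡
                     length (filter (λ x → f x ≟ suc (n * 2)) xs) + length (filter (λ x → f x ≟ n * 2) xs)
length-filter-⌊/2⌋ f n = length-filter-⊎ _ _ _ (λ x → ⌊m/2⌋≡n⇔ (f x) n)
  (λ q s → 1+n≢n (trans (sym q) s))

-- Alternating subsequences

-- Flipping `R` at each step merges `Alternating` and `Alternating′` into one predicate, so that a
-- single induction treats both directions.
Alt : Rel A 0ℓ → List A → Set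
Alt R []           = ⊤
Alt R (x ∷ [])     = ⊤
Alt R (x ∷ y ∷ zs) = R x y × Alt (flip R) (y ∷ zs)

mutual
  Alternating⇒Alt : ∀ xs → Alternating xs → Alt _>_ xs
  Alternating⇒Alt []           _       = tt
  Alternating⇒Alt (x ∷ [])     _       = tt
  Alternating⇒Alt (x ∷ y ∷ zs) (r , a) = r , Alternating′⇒Alt (y ∷ zs) a

  Alternating′⇒Alt : ∀ xs → Alternating′ xs → Alt _<_ xs
  Alternating′⇒Alt []           _       = tt
  Alternating′⇒Alt (x ∷ [])     _       = tt
  Alternating′⇒Alt (x ∷ y ∷ zs) (r , a) = r , Alternating⇒Alt (y ∷ zs) a

mutual
  Alt⇒Alternating : ∀ xs → Alt _>_ xs → Alternating xs
  Alt⇒Alternating []           _       = tt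
  Alt⇒Alternating (x ∷ [])     _       = tt
  Alt⇒Alternating (x ∷ y ∷ zs) (r , a) = r , Alt⇒Alternating′ (y ∷ zs) a

  Alt⇒Alternating′ : ∀ xs → Alt _<_ xs → Alternating′ xs
  Alt⇒Alternating′ []           _       = tt
  Alt⇒Alternating′ (x ∷ [])     _       = tt
  Alt⇒Alternating′ (x ∷ y ∷ zs) (r , a) = r , Alt⇒Alternating (y ∷ zs) a

-- The number of maximal monotone runs of x ∷ xs, not counting an initial run
-- that goes against R.
runs : {R : Rel A 0ℓ} → Decidable R → A → List A → ℕ
runs R? x []       = 0
runs R? x (y ∷ ys) with R? x y
... | yes _ = suc (runs (flip R?) y ys)
... | no  _ = runs R? y ys

runs-accept : (R? : Decidable R) {x y : A} (ys : List A) → R x y →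
              runs R? x (y ∷ ys) ≡ suc (runs (flip R?) y ys)
runs-accept R? {x} {y} ys r with R? x y
... | yes _ = refl
... | no ¬r = contradiction r ¬r

runs-reject : (R? : Decidable R) {x y : A} (ys : List A) → ¬ R x y →
              runs R? x (y ∷ ys) ≡ runs R? y ys
runs-reject R? {x} {y} ys ¬r with R? x y
... | yes r = contradiction r ¬r
... | no _  = refl

runs≤length : (R? : Decidable R) (x : A) (xs : List A) → runs R? x xs ≤ length xs
runs≤length R? x []       = z≤n
runs≤length R? x (y ∷ ys) with R? x y
... | yes _ = s≤s (runs≤length (flip R?) y ys)
... | no  _ = m≤n⇒m≤1+n (runs≤length R? y ys)

-- At the first step accepted by exactly one of `R` and its flip, the accepting count gains 1 and
-- both continue with the same remainder.
runs-flip : (R? : Decidable R) (x : A) (xs : List A) → runs R? x xs ≤ suc (runs (flip R?) x xs)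
runs-flip R? x []       = z≤n
runs-flip R? x (y ∷ ys) with R? x y | R? y x
... | yes _ | yes _ = s≤s (runs-flip (flip R?) y ys)
... | yes _ | no _  = ≤-refl
... | no _  | yes _ = m≤n⇒m≤1+n (m≤n⇒m≤1+n ≤-refl)
... | no _  | no _  = runs-flip R? y ys

flip-cotransitive : Cotransitive R → Cotransitive (flip R)
flip-cotransitive cotrans r z = swap (cotrans r z)

-- Induction on the word. If `R x y`, keeping `x` uses up one run and leaves a sequence alternating
-- for the flipped relation; dropping `x` gains nothing, by `runs-flip`.
Alt-length≤ : (R? : Decidable R) → Cotransitive R → (x : A) (xs : List A) {zs : List A} →
              zs ⊆ x ∷ xs → Alt R zs → length zs ≤ suc (runs R? x xs)
Alt-length≤ R? cotrans x [] (_ ∷ʳ [])   alt = z≤n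
Alt-length≤ R? cotrans x [] (refl ∷ []) alt = s≤s z≤n
Alt-length≤ R? cotrans x (y ∷ ys) (_ ∷ʳ zs⊆) alt
  with ih ← Alt-length≤ R? cotrans y ys zs⊆ alt | R? x y
... | yes _ = ≤-trans ih (s≤s (runs-flip R? y ys))
... | no _  = ih
Alt-length≤ R? cotrans x (y ∷ ys) {_ ∷ []}     (refl ∷ zs⊆) alt       = s≤s z≤n
Alt-length≤ R? cotrans x (y ∷ ys) {_ ∷ z ∷ zs} (refl ∷ zs⊆) (r , alt) with R? x y | zs⊆
... | yes _ | _ = s≤s (Alt-length≤ (flip R?) (flip-cotransitive cotrans) y ys zs⊆ alt)
... | no ¬r | refl ∷ _  = contradiction r ¬r
-- Here x can be replaced by y as the first term.
... | no ¬r | _ ∷ʳ zs⊆′ = Alt-length≤ R? cotrans y ys (refl ∷ zs⊆′) (Ryz , alt)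
  where Ryz = [ (λ r′ → contradiction r′ ¬r) , (λ r′ → r′) ]′ (cotrans r y)

-- The terms chosen are the points where the direction changes, followed by the last point. The
-- final clause carries the induction: `z` starts a sequence at least as well as `x`, so a term
-- standing in the right relation to the head of the word can be put before `z`.
Alt-longest : (R? : Decidable R) → Cotransitive R → (x : A) (xs : List A) →
              ∃₂ λ z zs → z ∷ zs ⊆ x ∷ xs × Alt R (z ∷ zs) × length zs ≡ runs R? x xs ×
                          (∀ {w} → R x w → R z w)
Alt-longest R? cotrans x [] = x , [] , refl ∷ [] , tt , refl , λ r → r
Alt-longest R? cotrans x (y ∷ ys) with R? x y
... | yes r with Alt-longest (flip R?) (flip-cotransitive cotrans) y ys
...   | z , zs , zs⊆ , alt , eq , lower =
        x , z ∷ zs , refl ∷ zs⊆ , (lower r , alt) , cong suc eq , λ r → r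
Alt-longest R? cotrans x (y ∷ ys) | no ¬r with Alt-longest R? cotrans y ys
...   | z , zs , zs⊆ , alt , eq , higher =
        z , zs , x ∷ʳ zs⊆ , alt , eq ,
        λ r → higher ([ (λ r′ → contradiction r′ ¬r) , (λ r′ → r′) ]′ (cotrans r y))

<-cotransitive : Cotransitive _<_
<-cotransitive {x} x<y z with x <? z
... | yes x<z = inj₁ x<z
... | no  x≮z = inj₂ (≤-<-trans (≮⇒≥ x≮z) x<y)

max-Alternating : ∀ x xs → max 0 (map length (filter alternating? (subsequences (x ∷ xs)))) ≡
                           suc (runs (flip _<?_) x xs)
max-Alternating x xs = ≤-antisym
  (max≤v⁺ z≤n (All.tabulate upper))
  (v≤max⁺ 0 _ (inj₂ lower))
  where
  cotrans : Cotransitive _>_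
  cotrans = flip-cotransitive {R = _<_} <-cotransitive

  lengths : List ℕ
  lengths = map length (filter alternating? (subsequences (x ∷ xs)))

  upper : ∀ {k} → k ∈ lengths → k ≤ suc (runs (flip _<?_) x xs)
  upper k∈ with ∈-map⁻ length k∈
  ... | zs , zs∈ , refl with ∈-filter⁻ alternating? {xs = subsequences (x ∷ xs)} zs∈
  ...   | zs∈′ , alt =
    Alt-length≤ (flip _<?_) cotrans x xs (∈-subsequences⇒⊆ (x ∷ xs) zs∈′) (Alternating⇒Alt zs alt)

  lower : Any (suc (runs (flip _<?_) x xs) ≤_) lengths
  lower with Alt-longest (flip _<?_) cotrans x xs
  ... | z , zs , zs⊆ , alt , eq , _ =
    Any.map (λ { refl → ≤-reflexive (cong suc (sym eq)) })
      (∈-map⁺ length (∈-filter⁺ alternating? (⊆⇒∈-subsequences zs⊆) (Alt⇒Alternating (z ∷ zs) alt)))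

-- Peaks

-- The centre is `1 + i`, which avoids predecessors. For `_<_` this is a peak, for the flipped
-- relation a valley.
Turn : Rel A 0ℓ → (ℕ → A) → ℕ → Set
Turn R f i = R (f i) (f (1 + i)) × R (f (2 + i)) (f (1 + i))

turn? : (R? : Decidable R) (f : ℕ → A) → Decidable₁ (Turn R f)
turn? R? f i = R? (f i) (f (1 + i)) ×-dec R? (f (2 + i)) (f (1 + i))

turns : {R : Rel A 0ℓ} → Decidable R → (ℕ → A) → ℕ → ℕ
turns R? f n = length (filter (turn? R? f) (upTo n))

turns-shift : (R? : Decidable R) (f : ℕ → A) (n : ℕ) →
              length (filter (turn? R? f) (applyUpTo suc n)) ≡ turns R? (f ∘ suc) n
turns-shift R? f n = length-filter-applyUpTo _ _ suc (λ i → i) n λ _ → mk⇔ (λ t → t) (λ t → t)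

turns-accept : (R? : Decidable R) (f : ℕ → A) (n : ℕ) → Turn R f 0 →
               turns R? f (suc n) ≡ suc (turns R? (f ∘ suc) n)
turns-accept R? f n t =
  trans (cong length (filter-accept (turn? R? f) t)) (cong suc (turns-shift R? f n))

turns-reject : (R? : Decidable R) (f : ℕ → A) (n : ℕ) → ¬ Turn R f 0 →
               turns R? f (suc n) ≡ turns R? (f ∘ suc) n
turns-reject R? f n ¬t =
  trans (cong length (filter-reject (turn? R? f) ¬t)) (turns-shift R? f n)

-- No step is a tie. The bound covers the steps among `f 0`, ..., `f (1 + n)`, the values that
-- `turns R? f n` inspects.
Comparable : Rel A 0ℓ → (ℕ → A) → ℕ → Set
Comparable R f n = ∀ {i} → i ≤ n → R (f i) (f (suc i)) ⊎ R (f (suc i)) (f i)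

-- Each turn ends a run along R and starts a run against R, so the turns are
-- numbered by every other run.
mutual
  turns-along : (R? : Decidable R) → Asymmetric R → (f : ℕ → A) (n : ℕ) → Comparable R f n →
                R (f 0) (f 1) →
                turns R? f n ≡ ⌈ runs (flip R?) (f 1) (applyUpTo (λ i → f (2 + i)) n) /2⌉
  turns-along R? asym f zero    cmp r = refl
  turns-along R? asym f (suc n) cmp r with cmp {1} (s≤s z≤n)
  ... | inj₁ r′ = trans (turns-reject R? f n (asym r′ ∘ proj₂))
        (trans (turns-along R? asym (f ∘ suc) n (cmp ∘ s≤s) r′)
               (cong ⌈_/2⌉ (sym (runs-reject (flip R?) _ (asym r′)))))
  -- Passing between the two lemmas rests on ⌈(m+1)/2⌉ = 1 + ⌊m/2⌋ here and ⌊(m+1)/2⌋ = ⌈m/2⌉ below,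
  -- both by computation.
  ... | inj₂ r′ = trans (turns-accept R? f n (r , r′))
        (trans (cong suc (turns-against R? asym (f ∘ suc) n (cmp ∘ s≤s) r′))
               (cong ⌈_/2⌉ (sym (runs-accept (flip R?) _ r′))))

  turns-against : (R? : Decidable R) → Asymmetric R → (f : ℕ → A) (n : ℕ) → Comparable R f n →
                  R (f 1) (f 0) →
                  turns R? f n ≡ ⌊ runs R? (f 1) (applyUpTo (λ i → f (2 + i)) n) /2⌋
  turns-against R? asym f zero    cmp r = refl
  turns-against R? asym f (suc n) cmp r with cmp {1} (s≤s z≤n)
  ... | inj₁ r′ = trans (turns-reject R? f n (asym r ∘ proj₁))
        (trans (turns-along R? asym (f ∘ suc) n (cmp ∘ s≤s) r′)
               (cong ⌊_/2⌋ (sym (runs-accept R? _ r′))))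
  ... | inj₂ r′ = trans (turns-reject R? f n (asym r ∘ proj₁))
        (trans (turns-against R? asym (f ∘ suc) n (cmp ∘ s≤s) r′)
               (cong ⌊_/2⌋ (sym (runs-reject R? _ (asym r′)))))

-- Values of a permutation and of its complement.

at-suc : ∀ {n} (π : Permutation′ n) {i} (i<n : i < n) →
         at π (suc i) ≡ suc (toℕ (π ⟨$⟩ʳ fromℕ< i<n))
at-suc {n} π {i} i<n with i <? n
... | yes i<n′ = cong (λ p → suc (toℕ (π ⟨$⟩ʳ fromℕ< p))) (<-irrelevant i<n′ i<n)
... | no  i≮n  = contradiction i<n i≮n

at-cong : ∀ {n} {π ρ : Permutation′ n} → π Perm.≈ ρ → ∀ i → at π i ≡ at ρ i
at-cong         π≈ρ zero    = refl
at-cong {n} {π} {ρ} π≈ρ (suc i) with i <? n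
... | yes _ = cong (suc ∘ toℕ) (π≈ρ _)
... | no  _ = refl

at-injective : ∀ {n} (π : Permutation′ n) {i j} → i < n → j < n →
               at π (suc i) ≡ at π (suc j) → i ≡ j
at-injective π {i} {j} i<n j<n eq = begin
  i                 ≡⟨ toℕ-fromℕ< i<n ⟨
  toℕ (fromℕ< i<n)  ≡⟨ cong toℕ (Injection.injective (↔⇒↣ π) (toℕ-injective (suc-injective
                         (trans (sym (at-suc π i<n)) (trans eq (at-suc π j<n)))))) ⟩
  toℕ (fromℕ< j<n)  ≡⟨ toℕ-fromℕ< j<n ⟩
  j                 ∎
  where open ≡-Reasoning

at-comparable : ∀ {n} (π : Permutation′ (suc n)) → Comparable _<_ (at π) n
-- The convention π(0) = 0 makes the step into position 1 an ascent.
at-comparable π {zero}  _   = inj₁ (subst (0 <_) (sym (at-suc π z<s)) z<s)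
at-comparable π {suc i} i<n with <-cmp (at π (suc i)) (at π (2 + i))
... | tri< lt _ _ = inj₁ lt
... | tri≈ _ eq _ = contradiction (sym (at-injective π (m≤n⇒m≤1+n i<n) (s≤s i<n) eq)) 1+n≢n
... | tri> _ _ gt = inj₂ gt

opposite-anti-< : ∀ {n} {i j : Fin n} → toℕ i < toℕ j → toℕ (opposite j) < toℕ (opposite i)
opposite-anti-< {n} {i} {j} i<j = subst₂ _<_ (sym (opposite-prop j)) (sym (opposite-prop i))
  (∸-monoʳ-< (s<s i<j) (toℕ<n j))

-- `∘ₚ` applies its left factor first, so the reversal acts on values, not on positions.
complement : ∀ {n} → Permutation′ n → Permutation′ n
complement π = π ∘ₚ Perm.reverse

complement-involutive : ∀ {n} (π : Permutation′ n) → complement (complement π) Perm.≈ π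
complement-involutive π i = opposite-involutive (π ⟨$⟩ʳ i)

at-complement-anti-< : ∀ {n} (π : Permutation′ n) {i j} → i < n → j < n →
                       at π (suc i) < at π (suc j) →
                       at (complement π) (suc j) < at (complement π) (suc i)
at-complement-anti-< π i<n j<n lt =
  subst₂ _<_ (sym (at-suc (complement π) j<n)) (sym (at-suc (complement π) i<n))
    (s<s (opposite-anti-< (s<s⁻¹ (subst₂ _<_ (at-suc π i<n) (at-suc π j<n) lt))))

at-complement-< : ∀ {n} (π : Permutation′ n) {i j} → i < n → j < n →
                  at (complement π) (suc i) < at (complement π) (suc j) ⇔
                  at π (suc j) < at π (suc i)
at-complement-< π {i} {j} i<n j<n = mk⇔
  (λ lt → subst₂ _<_ (at-cong (complement-involutive π) (suc j)) (at-cong (complement-involutive π) (suc i))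
            (at-complement-anti-< (complement π) i<n j<n lt))
  (at-complement-anti-< π j<n i<n)

-- Peaks and alternating subsequences in terms of runs.

downRuns : ∀ {n} → Permutation′ (suc n) → ℕ
downRuns {n} π = runs (flip _<?_) (at π 1) (applyUpTo (λ i → at π (2 + i)) n)

-- With the relation `flip _<?_` an initial ascending run is not counted, so `downRuns π` is the
-- number r of the opening comment.
as≡1+downRuns : ∀ {n} (π : Permutation′ (suc n)) → as π ≡ suc (downRuns π)
as≡1+downRuns {n} π = max-Alternating (at π 1) (applyUpTo (λ i → at π (2 + i)) n)

leftPeaks≡⌈downRuns/2⌉ : ∀ {n} (π : Permutation′ (suc n)) → leftPeaks π ≡ ⌈ downRuns π /2⌉
leftPeaks≡⌈downRuns/2⌉ {n} π = trans
  -- Position 0 is discarded by computation; position `1 + i` is the centre of turn `i`.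
  (length-filter-applyUpTo (leftPeak? π) (turn? _<?_ (at π)) suc (λ i → i) n
    λ _ → mk⇔ proj₂ (s≤s z≤n ,_))
  -- The sequence starts with the ascent from π(0) = 0, which accounts for the ceiling.
  (turns-along _<?_ <-asym (at π) n (at-comparable π) (subst (0 <_) (sym (at-suc π z<s)) z<s))

-- The interior peaks of the complement are the interior valleys of π.
interiorPeaks-complement : ∀ {n} (π : Permutation′ (suc n)) →
                           interiorPeaks (complement π) ≡ ⌊ downRuns π /2⌋
interiorPeaks-complement {zero}  π = refl
interiorPeaks-complement {suc n} π = trans
  (length-filter-applyUpTo (interiorPeak? (complement π)) (turn? (flip _<?_) f)
    (λ i → 2 + i) (λ i → i) n λ i<n → mk⇔
      (λ (_ , lt , gt) → Equivalence.to (<-iff (m<n⇒m<1+n (m<n⇒m<1+n i<n)) (s<s (m<n⇒m<1+n i<n))) lt ,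
                         Equivalence.to (<-iff (s<s (s<s i<n)) (s<s (m<n⇒m<1+n i<n))) gt)
      (λ (lt , gt) → s≤s (s≤s z≤n) ,
                     Equivalence.from (<-iff (m<n⇒m<1+n (m<n⇒m<1+n i<n)) (s<s (m<n⇒m<1+n i<n))) lt ,
                     Equivalence.from (<-iff (s<s (s<s i<n)) (s<s (m<n⇒m<1+n i<n))) gt))
  valleys
  where
  f : ℕ → ℕ
  f = at π ∘ suc
  <-iff : ∀ {i j} → i < 2 + n → j < 2 + n → _
  <-iff = at-complement-< π
  cmp : Comparable _>_ f n
  cmp i≤n = swap (at-comparable π (s≤s i≤n))
  valleys : turns (flip _<?_) f n ≡ ⌊ downRuns π /2⌋
  valleys with cmp {0} z≤n
  -- Without π(0) either direction may come first. An initial descent adds one to `downRuns` and an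
  -- initial ascent adds nothing; both cases give the floor.
  ... | inj₁ gt = trans (turns-along (flip _<?_) <-asym f n cmp gt)
                        (cong ⌊_/2⌋ (sym (runs-accept (flip _<?_) _ gt)))
  ... | inj₂ lt = trans (turns-against (flip _<?_) <-asym f n cmp lt)
                        (cong ⌊_/2⌋ (sym (runs-reject (flip _<?_) _ (<-asym lt))))

interiorPeaks-cong : ∀ {n} {π ρ : Permutation′ n} → π Perm.≈ ρ → interiorPeaks π ≡ interiorPeaks ρ
interiorPeaks-cong {n} {π} {ρ} π≈ρ = cong length (filter-≐ (interiorPeak? π) (interiorPeak? ρ)
  ((λ {i} → resp π≈ρ {i}) , (λ {i} → resp (sym ∘ π≈ρ) {i})) (upTo n))
  where
  resp : ∀ {π ρ : Permutation′ n} → π Perm.≈ ρ → ∀ {i} → InteriorPeak π i → InteriorPeak ρ i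
  resp e {i} (2≤i , lt , gt) = 2≤i , subst₂ _<_ (at-cong e (pred i)) (at-cong e i) lt ,
                                     subst₂ _<_ (at-cong e (suc i)) (at-cong e i) gt

-- Equidistribution under complementation

permutationSetoid : ℕ → Setoid 0ℓ 0ℓ
permutationSetoid n = record
  { Carrier       = Permutation′ n
  ; _≈_           = Perm._≈_
  ; isEquivalence = record
    { refl  = λ _ → refl
    ; sym   = λ e i → sym (e i)
    ; trans = λ e e′ i → trans (e i) (e′ i)
    }
  }

module _ (S : Setoid 0ℓ 0ℓ) where
  open Setoid S using () renaming (_≈_ to _∼_; sym to ∼-sym)

  lookup-injective : ∀ {xs} → AllPairs (λ x y → ¬ x ∼ y) xs → ∀ i j → lookup xs i ∼ lookup xs j → i ≡ j
  lookup-injective (_  ∷ _)  zero    zero    e = refl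
  lookup-injective (ne ∷ _)  zero    (suc j) e = contradiction e (All.lookup ne (∈-lookup j))
  lookup-injective (ne ∷ _)  (suc i) zero    e = contradiction (∼-sym e) (All.lookup ne (∈-lookup i))
  lookup-injective (_  ∷ us) (suc i) (suc j) e = cong suc (lookup-injective us i j e)

-- Send the index of each π satisfying `P` to the index of `f π` among the permutations satisfying
-- `Q`. `𝔖-complete` supplies that index, and `𝔖-distinct` with the injectivity of `f` makes this
-- map of finite sets injective.
#𝔖-≤ : ∀ n {P Q : Pred (Permutation′ n) 0ℓ} (P? : Decidable₁ P) (Q? : Decidable₁ Q)
       (f : Permutation′ n → Permutation′ n) → Injective Perm._≈_ Perm._≈_ f →
       Q Respects Perm._≈_ → (∀ {π} → P π → Q (f π)) → #𝔖 n P? ≤ #𝔖 n Q?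
#𝔖-≤ n {P} {Q} P? Q? f f-inj Q-resp P⇒Qf = injective⇒≤ {f = λ i → Any.index (image i)} λ {i} {j} e →
  lookup-injective 𝕊 (AllPairsₚ.filter⁺ P? (𝔖-distinct n)) i j
    (f-inj {πs i} {πs j} (Membershipₛ.index-injective 𝕊 {x₁ = f (πs i)} {f (πs j)} (image i) (image j) e))
  where
  𝕊 = permutationSetoid n
  πs : Fin (#𝔖 n P?) → Permutation′ n
  πs = lookup (filter P? (𝔖 n))

  image : ∀ i → Any (f (πs i) Perm.≈_) (filter Q? (𝔖 n))
  image i = Membershipₛ.∈-filter⁺ 𝕊 Q? (λ {π} {ρ} → Q-resp {π} {ρ}) (𝔖-complete (f (πs i)))
    (P⇒Qf (proj₂ (∈-filter⁻ P? {xs = 𝔖 n} (∈-lookup i))))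

-- Complementation is an involution, hence injective, and serves for both inequalities.
#𝔖-complement : ∀ n {P : Pred (Permutation′ n) 0ℓ} (P? : Decidable₁ P) → P Respects Perm._≈_ →
                #𝔖 n P? ≡ #𝔖 n (P? ∘ complement)
#𝔖-complement n {P} P? P-resp = ≤-antisym
  (#𝔖-≤ n P? (P? ∘ complement) complement (λ {π} {ρ} → complement-injective {π} {ρ})
    (λ {π} {ρ} e → P-resp {complement π} {complement ρ} (complement-cong {π} {ρ} e))
    (λ {π} → P-resp {π} {complement (complement π)} (λ i → sym (complement-involutive π i))))
  (#𝔖-≤ n (P? ∘ complement) P? complement (λ {π} {ρ} → complement-injective {π} {ρ})
    (λ {π} {ρ} → P-resp {π} {ρ}) (λ p → p))
  where
  complement-cong : Congruent Perm._≈_ Perm._≈_ (complement {n})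
  complement-cong e i = cong opposite (e i)
  complement-injective : Injective Perm._≈_ Perm._≈_ (complement {n})
  complement-injective {π} {ρ} e i = trans (sym (complement-involutive π i))
    (trans (cong opposite (e i)) (complement-involutive ρ i))

#𝔖-cong : ∀ n {P Q : Pred (Permutation′ n) 0ℓ} (P? : Decidable₁ P) (Q? : Decidable₁ Q) →
          P ≐ Q → #𝔖 n P? ≡ #𝔖 n Q?
#𝔖-cong n P? Q? P≐Q = cong length (filter-≐ P? Q? P≐Q (𝔖 n))

#𝔖-≗ : ∀ n {f g : Permutation′ n → ℕ} → f ≗ g → ∀ k →
       #𝔖 n (λ π → f π ≟ k) ≡ #𝔖 n (λ π → g π ≟ k)
#𝔖-≗ n f≗g k = #𝔖-cong n _ _ ((λ {π} → trans (sym (f≗g π))) , (λ {π} → trans (f≗g π)))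

-- Peak numbers as sums of two consecutive a_k(n).

W~≡ : ∀ n j → W~ (suc n) j ≡ a (suc (j * 2)) (suc n) + a (j * 2) (suc n)
W~≡ n j = trans
  (#𝔖-≗ (suc n) (λ π → trans (leftPeaks≡⌈downRuns/2⌉ π) (cong ⌊_/2⌋ (sym (as≡1+downRuns π)))) j)
  (length-filter-⌊/2⌋ as j (𝔖 (suc n)))

-- Here r itself is halved, not r + 1. The values r = 2j and r = 2j + 1 become as = 2j + 1 and as =
-- 2j + 2, one higher than in `W~≡`.
W≡ : ∀ n j → W (suc n) j ≡ a (2 + j * 2) (suc n) + a (suc (j * 2)) (suc n)
W≡ n j = begin
  W (suc n) j
    ≡⟨ #𝔖-complement (suc n) (λ π → interiorPeaks π ≟ j)
         (λ {π} {ρ} e → trans (sym (interiorPeaks-cong {π = π} {ρ} e))) ⟩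
  #𝔖 (suc n) (λ π → interiorPeaks (complement π) ≟ j)
    ≡⟨ #𝔖-≗ (suc n) interiorPeaks-complement j ⟩
  #𝔖 (suc n) (λ π → ⌊ downRuns π /2⌋ ≟ j)
    ≡⟨ length-filter-⌊/2⌋ downRuns j (𝔖 (suc n)) ⟩
  #𝔖 (suc n) (λ π → downRuns π ≟ suc (j * 2)) + #𝔖 (suc n) (λ π → downRuns π ≟ j * 2)
    ≡⟨ cong₂ _+_ (downRuns⇒as (suc (j * 2))) (downRuns⇒as (j * 2)) ⟩
  a (2 + j * 2) (suc n) + a (suc (j * 2)) (suc n) ∎
  where
  open ≡-Reasoning
  downRuns⇒as : ∀ k → #𝔖 (suc n) (λ π → downRuns π ≟ k) ≡ a (suc k) (suc n)
  downRuns⇒as k = #𝔖-cong (suc n) _ _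
    ( (λ {π} e → trans (as≡1+downRuns π) (cong suc e))
    , (λ {π} e → suc-injective (trans (sym (as≡1+downRuns π)) e)))

as≤n : ∀ {n} (π : Permutation′ (suc n)) → as π ≤ suc n
as≤n {n} π = subst (_≤ suc n) (sym (as≡1+downRuns π))
  (s≤s (≤-trans (runs≤length (flip _<?_) _ (applyUpTo _ n)) (≤-reflexive (length-applyUpTo _ n))))

-- `W~≡` at `j = 0` involves `a 0`, whereas the constant coefficient of `T[x]` is 0 by definition;
-- this reconciles them.
a-zero : ∀ n → a 0 (suc n) ≡ 0
a-zero n = trans (#𝔖-≗ (suc n) as≡1+downRuns 0) (none (𝔖 (suc n)))
  where
  none : ∀ πs → length (filter (λ π → suc (downRuns π) ≟ 0) πs) ≡ 0
  none []       = refl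
  none (π ∷ πs) = none πs

-- Coefficients

coeff-⊕ : ∀ p q k → coeff (p ⊕ q) k ≡ coeff p k + coeff q k
coeff-⊕ []      q       k       = refl
coeff-⊕ (a ∷ p) []      k       = sym (+-identityʳ _)
coeff-⊕ (a ∷ p) (b ∷ q) zero    = refl
coeff-⊕ (a ∷ p) (b ∷ q) (suc k) = coeff-⊕ p q k

coeff-map-* : ∀ c p k → coeff (map (c *_) p) k ≡ c * coeff p k
coeff-map-* c []      k       = sym (*-zeroʳ c)
coeff-map-* c (a ∷ p) zero    = refl
coeff-map-* c (a ∷ p) (suc k) = coeff-map-* c p k

coeff-∷⊗-zero : ∀ c p q → coeff ((c ∷ p) ⊗ q) 0 ≡ c * coeff q 0
coeff-∷⊗-zero c p q = trans (coeff-⊕ (map (c *_) q) _ 0)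
  (trans (+-identityʳ _) (coeff-map-* c q 0))

coeff-∷⊗-suc : ∀ c p q k → coeff ((c ∷ p) ⊗ q) (suc k) ≡ c * coeff q (suc k) + coeff (p ⊗ q) k
coeff-∷⊗-suc c p q k = trans (coeff-⊕ (map (c *_) q) _ (suc k))
  (cong (_+ _) (coeff-map-* c q (suc k)))

coeff-𝟙⊗ : ∀ q k → coeff (𝟙 ⊗ q) k ≡ coeff q k
coeff-𝟙⊗ q zero    = trans (coeff-∷⊗-zero 1 [] q) (*-identityˡ _)
coeff-𝟙⊗ q (suc k) = trans (coeff-∷⊗-suc 1 [] q k) (trans (+-identityʳ _) (*-identityˡ _))

coeff-X⊗-suc : ∀ q k → coeff (X ⊗ q) (suc k) ≡ coeff q k
coeff-X⊗-suc q k = trans (coeff-∷⊗-suc 0 𝟙 q k) (coeff-𝟙⊗ q k)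

coeff-𝟙⊕X⊗-suc : ∀ q k → coeff ((𝟙 ⊕ X) ⊗ q) (suc k) ≡ coeff q (suc k) + coeff q k
coeff-𝟙⊕X⊗-suc q k = trans (coeff-∷⊗-suc 1 𝟙 q k) (cong₂ _+_ (*-identityˡ _) (coeff-𝟙⊗ q k))

coeff-X²⊗-suc-suc : ∀ q k → coeff ((X ⊗ X) ⊗ q) (2 + k) ≡ coeff q k
coeff-X²⊗-suc-suc q k = trans (coeff-∷⊗-suc 0 X q (suc k)) (coeff-X⊗-suc q k)

-- In the Horner form of substitution, removing the constant term `c` exposes one factor X². The
-- parity statements follow by induction.
coeff-[X²]-suc-suc : ∀ c p k → coeff ((c ∷ p) [ X ⊗ X ]) (2 + k) ≡ coeff (p [ X ⊗ X ]) k
coeff-[X²]-suc-suc c p k = trans (coeff-⊕ (c ∷ []) ((X ⊗ X) ⊗ p [ X ⊗ X ]) (2 + k)) (coeff-X²⊗-suc-suc (p [ X ⊗ X ]) k)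

coeff-[X²]-even : ∀ p j → coeff (p [ X ⊗ X ]) (j * 2) ≡ coeff p j
coeff-[X²]-even []      j       = refl
coeff-[X²]-even (c ∷ p) zero    = trans (coeff-⊕ (c ∷ []) ((X ⊗ X) ⊗ p [ X ⊗ X ]) 0)
  (trans (cong (c +_) (coeff-∷⊗-zero 0 X (p [ X ⊗ X ]))) (+-identityʳ c))
coeff-[X²]-even (c ∷ p) (suc j) = trans (coeff-[X²]-suc-suc c p (j * 2)) (coeff-[X²]-even p j)

coeff-[X²]-odd : ∀ p j → coeff (p [ X ⊗ X ]) (suc (j * 2)) ≡ 0
coeff-[X²]-odd []      j       = refl
coeff-[X²]-odd (c ∷ p) zero    = trans (coeff-⊕ (c ∷ []) ((X ⊗ X) ⊗ p [ X ⊗ X ]) 1)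
  (trans (coeff-∷⊗-suc 0 X (p [ X ⊗ X ]) 0) (coeff-∷⊗-zero 0 𝟙 (p [ X ⊗ X ])))
coeff-[X²]-odd (c ∷ p) (suc j) = trans (coeff-[X²]-suc-suc c p (suc (j * 2))) (coeff-[X²]-odd p j)

coeff-X⊗[X²]-even : ∀ p j → coeff (X ⊗ p [ X ⊗ X ]) (j * 2) ≡ 0
coeff-X⊗[X²]-even p zero    = coeff-∷⊗-zero 0 𝟙 (p [ X ⊗ X ])
coeff-X⊗[X²]-even p (suc j) = trans (coeff-X⊗-suc (p [ X ⊗ X ]) (suc (j * 2))) (coeff-[X²]-odd p j)

-- Past the end of the list `coeff` defaults to 0, in agreement with the vanishing of `f`.
coeff-applyUpTo : ∀ f n → (∀ k → n ≤ k → f k ≡ 0) → ∀ k → coeff (applyUpTo f n) k ≡ f k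
coeff-applyUpTo f zero    vanish k       = sym (vanish k z≤n)
coeff-applyUpTo f (suc n) vanish zero    = refl
coeff-applyUpTo f (suc n) vanish (suc k) = coeff-applyUpTo (f ∘ suc) n (λ k → vanish (suc k) ∘ s≤s) k

coeff-C-even : ∀ n j → coeff (C[x] n) (j * 2) ≡ W~ n j
coeff-C-even n j = begin
  coeff (C[x] n) (j * 2)
    ≡⟨ coeff-⊕ (X ⊗ W[x] n [ X ⊗ X ]) _ (j * 2) ⟩
  coeff (X ⊗ W[x] n [ X ⊗ X ]) (j * 2) + coeff (W~[x] n [ X ⊗ X ]) (j * 2)
    ≡⟨ cong₂ _+_ (coeff-X⊗[X²]-even (W[x] n) j) (coeff-[X²]-even (W~[x] n) j) ⟩
  coeff (W~[x] n) j
    ≡⟨ coeff-applyUpTo (W~ n) (suc n) (λ _ → W~-vanishes) j ⟩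
  W~ n j ∎
  where open ≡-Reasoning

coeff-C-odd : ∀ n j → coeff (C[x] n) (suc (j * 2)) ≡ W n j
coeff-C-odd n j = begin
  coeff (C[x] n) (suc (j * 2))
    ≡⟨ coeff-⊕ (X ⊗ W[x] n [ X ⊗ X ]) _ (suc (j * 2)) ⟩
  coeff (X ⊗ W[x] n [ X ⊗ X ]) (suc (j * 2)) + coeff (W~[x] n [ X ⊗ X ]) (suc (j * 2))
    ≡⟨ cong₂ _+_ (coeff-X⊗-suc (W[x] n [ X ⊗ X ]) (j * 2)) (coeff-[X²]-odd (W~[x] n) j) ⟩
  coeff (W[x] n [ X ⊗ X ]) (j * 2) + 0
    ≡⟨ +-identityʳ _ ⟩
  coeff (W[x] n [ X ⊗ X ]) (j * 2)
    ≡⟨ coeff-[X²]-even (W[x] n) j ⟩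
  coeff (W[x] n) j
    ≡⟨ coeff-applyUpTo (W n) (suc n) (λ _ → W-vanishes) j ⟩
  W n j ∎
  where open ≡-Reasoning

coeff-T : ∀ n k → coeff (T[x] (suc n)) k ≡ a k (suc n)
coeff-T n zero    = sym (a-zero n)
coeff-T n (suc k) = coeff-applyUpTo (λ j → a (suc j) (suc n)) (suc n)
  (λ k n<k → #𝔖-vanishes (suc n) as as≤n (s≤s n<k)) k

-- Even coefficients come from left peaks and odd ones from interior peaks; the two index shifts
-- make the formula uniform in `k`.
coeff-C : ∀ n k → coeff (C[x] (suc n)) k ≡ a (suc k) (suc n) + a k (suc n)
-- Abstracting the half as `j` lets `refl` replace `k` by `suc (j * 2)` or `j * 2`.
coeff-C n k with ⌊ k /2⌋ | n≡1+⌊n/2⌋*2⊎n≡⌊n/2⌋*2 k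
... | j | inj₁ refl = trans (coeff-C-odd (suc n) j) (W≡ n j)
... | j | inj₂ refl = trans (coeff-C-even (suc n) j) (W~≡ n j)

theorem3 : (n : ℕ) → n ≥ 2 → X ⊗ C[x] n ≈ (𝟙 ⊕ X) ⊗ T[x] n
-- Both constant coefficients are 0: on the left by the factor `X`, on the right by the leading 0 of
-- `T[x]`.
theorem3 (suc n) _ zero    =
  trans (coeff-∷⊗-zero 0 𝟙 (C[x] (suc n))) (sym (coeff-∷⊗-zero 1 𝟙 (T[x] (suc n))))
theorem3 (suc n) _ (suc k) = begin
  coeff (X ⊗ C[x] (suc n)) (suc k)                    ≡⟨ coeff-X⊗-suc (C[x] (suc n)) k ⟩
  coeff (C[x] (suc n)) k                              ≡⟨ coeff-C n k ⟩
  a (suc k) (suc n) + a k (suc n)                     ≡⟨ cong₂ _+_ (coeff-T n (suc k)) (coeff-T n k) ⟨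
  coeff (T[x] (suc n)) (suc k) + coeff (T[x] (suc n)) k ≡⟨ coeff-𝟙⊕X⊗-suc (T[x] (suc n)) k ⟨
  coeff ((𝟙 ⊕ X) ⊗ T[x] (suc n)) (suc k)              ∎
  where open ≡-Reasoning
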